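{- Let $n\ge 1$. For every parking function $f\in \mathrm{PF}_n$, $$\mathrm{dinv}(f)=\mathrm{area}(\phi_n(f)).$$
   Context: Let $n\geq 1$ and $[n]=\{1,\dots,n\}$. A parking function of size $n$ is a function $f:[n]\to[n]$ with $|f^{ -1}(\{1,\dots,m\})|\ge m$ for all $m\in[n]$; $\mathrm{PF}_n$ is the set of these. Elements of $[n]$ are called labels. A parking function is identified with a labelled Dyck path from $(0,0)$ to $(n,n)$ (north and east unit steps, never below the diagonal $y=x$): the north steps on the line $x=i-1$ carry the labels in $f^{ -1}(i)$, increasing from bottom to top. So label $\lambda$ lies in column $f(\lambda)$, and the rows, numbered $1,\dots,n$ from bottom to top, each contain exactly one label (the labels ordered by increasing $f(\lambda)$, ties broken by increasing $\lambda$). Area: $a_\lambda(f)$ is the number of whole unit squares between the path and the main diagonal $y=x$ in the row containing $\lambda$; if $\lambda$ is in row $i$, then $a_\lambda(f)=i-f(\lambda)$. $\mathrm{area}(f)=\sum_{\lambda\in[n]}a_\lambda(f)$. Dinv: $\mathrm{Dinv}(f)$ is the set of pairs $\{\lambda,\mu\}\subseteq[n]$ with $\lambda<\mu$ such that either (A) $f(\lambda)<f(\mu)$ and $a_\lambda(f)=a_\mu(f)$, or (B) $f(\lambda)>f(\mu)$ and $a_\lambda(f)+1=a_\mu(f)$. $\mathrm{dinv}(f)=\#\mathrm{Dinv}(f)$. The map $\phi_n$: the dinv reading word of $f$ is the word $w_1w_2\cdots w_n$ listing all labels in increasing order with respect to the total order in which $\lambda$ precedes $\mu$ iff $a_\lambda(f)<a_\mu(f)$,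 or $a_\lambda(f)=a_\mu(f)$ and $f(\lambda)<f(\mu)$. For $\lambda=w_j$ set $d_\lambda(f)=\#\{\{w_i,w_j\}\in\mathrm{Dinv}(f) : i<j\}$. Then $\phi_n:\mathrm{PF}_n\to\mathrm{PF}_n$ is defined by $(\phi_n(f))(w_i)=i-d_{w_i}(f)$ for all $i\in[n]$ (this is indeed a parking function). -}

module Defs where

open import Data.Fin.Base using (Fin; zero; suc; toℕ; fromℕ<; cast; inject₁; inject≤; _≤_; _<_)
open import Data.Fin.Properties as Fin
  using (toℕ<n; toℕ-fromℕ<; fromℕ<-injective; toℕ-injective; toℕ-cast; toℕ-inject₁;
         toℕ-inject≤; inject≤-injective; injective⇒≤; _≤?_; _<?_)
open import Data.List.Base using (List; []; _∷_; length; filter; allFin; lookup; cartesianProduct)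
open import Data.List.Properties using (length-tabulate)
open import Data.List.Membership.Propositional using (_∈_)
open import Data.List.Membership.Propositional.Properties
  using (∈-allFin; ∈-filter⁺; ∈-filter⁻; ∈-lookup)
open import Data.List.Membership.Setoid.Properties using (index-injective)
open import Data.List.Relation.Binary.Permutation.Propositional using (↭-sym; ↭⇒↭ₛ)
open import Data.List.Relation.Binary.Permutation.Propositional.Properties
  using (∈-resp-↭; ↭-length)
open import Data.List.Relation.Binary.Permutation.Setoid.Properties using (Unique-resp-↭)
open import Data.List.Relation.Unary.All as All using (All)
open import Data.List.Relation.Unary.AllPairs using (_∷_)
open import Data.List.Relation.Unary.Any using (index)
open import Data.List.Relation.Unary.Any.Properties using (lookup-index)
open import Data.List.Relation.Unary.Sorted.TotalOrder.Properties using (lookup-mono-≤)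
open import Data.List.Relation.Unary.Unique.Propositional using (Unique)
open import Data.List.Relation.Unary.Unique.Propositional.Properties using (allFin⁺; filter⁺)
open import Data.List.Sort using (sort; sort-↭; sort-↗)
open import Data.Nat.Base as ℕ using (ℕ; zero; suc; _+_; _∸_; z≤n; s≤s)
import Data.Nat.Properties as ℕ
open import Data.Product.Base using (_×_; _,_; proj₁; proj₂)
open import Data.Product.Relation.Binary.Lex.NonStrict using (×-decTotalOrder)
open import Data.Sum.Base using (_⊎_; inj₁; inj₂)
open import Algebra.Properties.CommutativeMonoid.Sum ℕ.+-0-commutativeMonoid using (sum)
open import Function.Base using (_∘_)
open import Level using (Level; 0ℓ)
open import Relation.Binary.Bundles using (DecTotalOrder)
import Relation.Binary.Construct.On as On
open import Relation.Binary.PropositionalEquality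
  using (_≡_; refl; sym; trans; cong; cong₂; subst; setoid)
open import Relation.Nullary.Decidable using (Dec; _×-dec_; _⊎-dec_)
open import Relation.Nullary.Negation using (contradiction)
open import Relation.Unary using (Pred; Decidable)

private
  variable
    ℓ : Level
    m n : ℕ

count : {P : Pred (Fin n) ℓ} → Decidable P → ℕ
count {n} P? = length (filter P? (allFin n))

private
  lookup-injective : ∀ {A : Set} {xs : List A} → Unique xs →
                     ∀ {i j} → lookup xs i ≡ lookup xs j → i ≡ j
  lookup-injective (_ ∷ _)  {zero}  {zero}  _  = refl
  lookup-injective (x∉ ∷ _) {zero}  {suc j} eq = contradiction eq (All.lookup x∉ (∈-lookup j))
  lookup-injective (x∉ ∷ _) {suc i} {zero}  eq = contradiction (sym eq) (All.lookup x∉ (∈-lookup i))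
  lookup-injective (_ ∷ u)  {suc i} {suc j} eq = cong suc (lookup-injective u eq)

module _ {P : Pred (Fin n) ℓ} (P? : Decidable P) where

  ≤-count : (g : Fin m → Fin n) → (∀ {i j} → g i ≡ g j → i ≡ j) →
            (∀ i → P (g i)) → m ℕ.≤ count P?
  ≤-count g g-inj p = injective⇒≤ (g-inj ∘ index-injective (setoid _) (mem _) (mem _))
    where
    mem : ∀ i → g i ∈ filter P? (allFin n)
    mem i = ∈-filter⁺ P? (∈-allFin (g i)) (p i)

  count-≤ : (g : Fin n → Fin n) → (∀ {i j} → g i ≡ g j → i ≡ j) →
            (∀ i → P i → toℕ (g i) ℕ.< m) → count P? ℕ.≤ m
  count-≤ g g-inj p = injective⇒≤ {f = λ i → fromℕ< (bound i)}
    (lookup-injective (filter⁺ P? (allFin⁺ n)) ∘ g-inj ∘ toℕ-injective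
      ∘ fromℕ<-injective _ _ (bound _) (bound _))
    where
    bound : ∀ i → toℕ (g (lookup (filter P? (allFin n)) i)) ℕ.< _
    bound i = p _ (proj₂ (∈-filter⁻ P? {xs = allFin n} (∈-lookup i)))

-- All the elements of Fin n, listed in increasing order of their keys.
module Listing (O : DecTotalOrder 0ℓ 0ℓ 0ℓ) (key : Fin n → DecTotalOrder.Carrier O) where

  private
    byKey = On.decTotalOrder O key

  word : List (Fin n)
  word = sort byKey (allFin n)

  private
    ↭-allFin = sort-↭ byKey (allFin n)

    length-word : length word ≡ n
    length-word = trans (↭-length ↭-allFin) (length-tabulate {n = n} _)

    ∈-word : ∀ x → x ∈ word
    ∈-word x = ∈-resp-↭ (↭-sym ↭-allFin) (∈-allFin x)

    unique-word : Unique word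
    unique-word = Unique-resp-↭ (setoid _) (↭⇒↭ₛ (↭-sym ↭-allFin)) (allFin⁺ n)

  letter : Fin n → Fin n
  letter i = lookup word (cast (sym length-word) i)

  position : Fin n → Fin n
  position x = cast length-word (index (∈-word x))

  letter-position : ∀ x → letter (position x) ≡ x
  letter-position x = trans
    (cong (lookup word) (toℕ-injective (trans (toℕ-cast _ (position x)) (toℕ-cast _ (index (∈-word x))))))
    (sym (lookup-index (∈-word x)))

  letter-injective : ∀ {i j} → letter i ≡ letter j → i ≡ j
  letter-injective {i} {j} eq = toℕ-injective (trans (sym (toℕ-cast _ i))
    (trans (cong toℕ (lookup-injective unique-word eq)) (toℕ-cast _ j)))

  position-letter : ∀ i → position (letter i) ≡ i
  position-letter i = letter-injective (letter-position (letter i))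

  position-injective : ∀ {x y} → position x ≡ position y → x ≡ y
  position-injective {x} {y} eq =
    trans (sym (letter-position x)) (trans (cong letter eq) (letter-position y))

  open DecTotalOrder O using () renaming (_≤_ to _≤ₖ_)

  key-mono : ∀ {x y} → position x ≤ position y → key x ≤ₖ key y
  key-mono {x} {y} p = subst (λ z → key z ≤ₖ key y) (letter-position x)
    (subst (λ z → key (letter (position x)) ≤ₖ key z) (letter-position y)
      (lookup-mono-≤ (DecTotalOrder.totalOrder byKey) (sort-↗ byKey (allFin n))
        (subst (ℕ._≤ _) (sym (toℕ-cast _ (position x)))
          (subst (toℕ (position x) ℕ.≤_) (sym (toℕ-cast _ (position y))) p))))

-- Labels, columns, rows and positions in words are all numbered from 0, i.e.
-- Fin n stands for [n] with every number lowered by one; {1,…,m} with 1 ≤ m ≤ n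
-- is then { i | i ≤ k } for k : Fin n the counterpart of m, and has suc (toℕ k)
-- elements.
record PF (n : ℕ) : Set where
  constructor mkPF
  field
    fun     : Fin n → Fin n
    parking : ∀ (k : Fin n) → suc (toℕ k) ℕ.≤ count (λ x → fun x ≤? k)

open PF public

module Rows {n} (f : PF n) =
  Listing (×-decTotalOrder (Fin.≤-decTotalOrder n) (Fin.≤-decTotalOrder n)) (λ x → fun f x , x)

row : PF n → Fin n → Fin n
row f = Rows.position f

fun≤row : (f : PF n) → ∀ x → fun f x ≤ row f x
fun≤row f x with fun f x in eq
... | zero  = z≤n
... | suc k = ℕ.≤-trans
  (subst (λ j → suc j ℕ.≤ count (λ y → fun f y ≤? inject₁ k)) (toℕ-inject₁ k) (parking f (inject₁ k)))
  (count-≤ (λ y → fun f y ≤? inject₁ k) (row f) (Rows.position-injective f) earlier)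
  where
  earlier : ∀ y → fun f y ≤ inject₁ k → row f y < row f x
  earlier y y≤k = ℕ.≰⇒> λ x≤y → ℕ.<⇒≱ fy<fx (fst≤ (Rows.key-mono f x≤y))
    where
    fy<fx : fun f y < fun f x
    fy<fx = subst (λ z → suc (toℕ (fun f y)) ℕ.≤ toℕ z) (sym eq)
      (s≤s (subst (toℕ (fun f y) ℕ.≤_) (toℕ-inject₁ k) y≤k))
    fst≤ : DecTotalOrder._≤_ (×-decTotalOrder (Fin.≤-decTotalOrder _) (Fin.≤-decTotalOrder _))
             (fun f x , x) (fun f y , y) → fun f x ≤ fun f y
    fst≤ (inj₁ (le , _)) = le
    fst≤ (inj₂ (e , _))  = ℕ.≤-reflexive (cong toℕ e)

-- Never truncated, by fun≤row.
rowArea : PF n → Fin n → ℕ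
rowArea f x = toℕ (row f x) ∸ toℕ (fun f x)

area : PF n → ℕ
area f = sum (rowArea f)

-- The condition for {x, y} with x < y to belong to Dinv(f).
DinvPair : PF n → Fin n × Fin n → Set
DinvPair f (x , y) =
  x < y × ((fun f x < fun f y × rowArea f x ≡ rowArea f y)
         ⊎ (fun f y < fun f x × rowArea f x + 1 ≡ rowArea f y))

dinvPair? : (f : PF n) → Decidable (DinvPair f)
dinvPair? f (x , y) =
  x <? y ×-dec ((fun f x <? fun f y ×-dec (rowArea f x ℕ.≟ rowArea f y))
         ⊎-dec (fun f y <? fun f x ×-dec (rowArea f x + 1 ℕ.≟ rowArea f y)))

dinv : PF n → ℕ
dinv {n} f = length (filter (dinvPair? f) (cartesianProduct (allFin n) (allFin n)))

-- {x, y} ∈ Dinv(f) as an unordered pair.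
InDinv : PF n → Fin n → Fin n → Set
InDinv f x y = DinvPair f (x , y) ⊎ DinvPair f (y , x)

inDinv? : (f : PF n) → ∀ x y → Dec (InDinv f x y)
inDinv? f x y = dinvPair? f (x , y) ⊎-dec dinvPair? f (y , x)

reading-key-injective : (f : PF n) → ∀ {x y} →
                        rowArea f x ≡ rowArea f y → fun f x ≡ fun f y → x ≡ y
reading-key-injective f {x} {y} a≡ f≡ = Rows.position-injective f (toℕ-injective
  (trans (sym (ℕ.m∸n+n≡m (fun≤row f x)))
    (trans (cong₂ _+_ a≡ (cong toℕ f≡)) (ℕ.m∸n+n≡m (fun≤row f y)))))

-- The dinv reading word; it has no ties, by reading-key-injective.
module Reading {n} (f : PF n) =
  Listing (×-decTotalOrder ℕ.≤-decTotalOrder (Fin.≤-decTotalOrder n)) (λ x → rowArea f x , fun f x)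

dinvCount : PF n → Fin n → ℕ
dinvCount f x = count (λ i → i <? position x ×-dec inDinv? f (letter i) x)
  where open Reading f

dinvCount≤position : (f : PF n) → ∀ x → dinvCount f x ℕ.≤ toℕ (Reading.position f x)
dinvCount≤position f x =
  count-≤ (λ i → i <? position x ×-dec inDinv? f (letter i) x) (λ i → i) (λ e → e) (λ _ → proj₁)
  where open Reading f

-- Never truncated, by dinvCount≤position; φ-letter below gives the value at
-- each letter of the reading word.
φ-fun : PF n → Fin n → Fin n
φ-fun f x = fromℕ< (ℕ.≤-<-trans (ℕ.m∸n≤m (toℕ (position x)) (dinvCount f x)) (toℕ<n (position x)))
  where open Reading f

φ-letter : (f : PF n) → let open Reading f in
           ∀ i → toℕ (φ-fun f (letter i)) ≡ toℕ i ∸ dinvCount f (letter i)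
φ-letter f i = trans (toℕ-fromℕ< _)
  (cong (λ j → toℕ j ∸ dinvCount f (letter i)) (position-letter i))
  where open Reading f

φ : PF n → PF n
φ {n} f = mkPF (φ-fun f) λ k →
  ≤-count (λ x → φ-fun f x ≤? k) (λ i → letter (inject≤ i (toℕ<n k)))
    (λ eq → inject≤-injective _ _ _ _ (letter-injective eq))
    λ i → ℕ.≤-trans (ℕ.≤-reflexive (φ-letter f (inject≤ i (toℕ<n k))))
      (ℕ.≤-trans (ℕ.m∸n≤m (toℕ (inject≤ i (toℕ<n k)))
                       (dinvCount f (letter (inject≤ i (toℕ<n k)))))
        (ℕ.≤-trans (ℕ.≤-reflexive (toℕ-inject≤ i (toℕ<n k))) (ℕ.≤-pred (toℕ<n i))))
  where open Reading f

{-# OPTIONS --safe #-}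

-- Rows and positions in the reading word are both permutations of the labels,
-- so area (φ f) = Σ row − Σ φ f = Σᵢ i − Σᵢ (i − d_{wᵢ}) = Σ d. Each pair of
-- Dinv(f) contributes to exactly one d, that of its later letter in the reading
-- word, whence Σ d = dinv f.
module Submission where

open import Data.Bool.Base using (true; false; if_then_else_)
open import Data.Fin.Base using (Fin; zero; suc; toℕ; _<_)
open import Data.Fin.Permutation using (Permutation; permutation)
open import Data.Fin.Properties using (toℕ-fromℕ<; <-cmp; _<?_)
open import Data.List.Base using (_++_; length; filter; map; tabulate; cartesianProduct)
open import Data.List.Properties using (filter-++; length-++; map-tabulate)
open import Data.Nat.Base using (ℕ; zero; suc; _+_; _≤_)
import Data.Nat.Properties as ℕ
open import Data.Product.Base using (_×_; _,_; proj₁; proj₂)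
open import Data.Sum.Base using (_⊎_; inj₁; inj₂; [_,_])
open import Algebra.Properties.CommutativeMonoid.Sum ℕ.+-0-commutativeMonoid
  using (sum; sum-cong-≗; sum-permute; ∑-distrib-+; ∑-comm)
open import Function.Base using (_∘_; id)
open import Function.Bundles using (mk⇔)
open import Level using (Level)
open import Relation.Binary.Definitions using (tri<; tri≈; tri>)
open import Relation.Binary.PropositionalEquality
  using (_≡_; refl; sym; trans; cong; cong₂; module ≡-Reasoning)
open import Relation.Nullary.Decidable using (Dec; yes; no; does; does-⇔; _×-dec_; _⊎-dec_)
open import Relation.Nullary.Negation using (¬_; contradiction)
open import Relation.Unary using (Pred; Decidable)
open import Defs
  using (PF; fun; dinv; area; φ; row; fun≤row; rowArea; DinvPair; dinvPair?; inDinv?;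
         dinvCount; dinvCount≤position; φ-fun; module Rows; module Reading)

private
  variable
    a p q : Level
    A B : Set a
    P : Set p
    Q : Set q
    m n : ℕ

-- It looks at `does` alone, so it reduces together with `filter`, and the proofs inside a decision
-- never matter.
indicator : Dec P → ℕ
indicator d = if does d then 1 else 0

indicator-⇔ : (P → Q) → (Q → P) → (d : Dec P) (e : Dec Q) → indicator d ≡ indicator e
indicator-⇔ f g d e = cong (if_then 1 else 0) (does-⇔ (mk⇔ f g) d e)

indicator-⊎ : (d : Dec P) (e : Dec Q) → (P → ¬ Q) →
              indicator (d ⊎-dec e) ≡ indicator d + indicator e
indicator-⊎ (yes x) (yes y) disjoint = contradiction y (disjoint x)
indicator-⊎ (yes _) (no _)  _        = refl
indicator-⊎ (no _)  _       _        = refl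

-- Counts become sums, which can be reindexed and interchanged. An arbitrary `g` lets the induction
-- pass to `g ∘ suc`; `allFin n` is the case `g = id`.
length-filter-tabulate : {P : Pred A p} (P? : Decidable P) (g : Fin n → A) →
                         length (filter P? (tabulate g)) ≡ sum (λ i → indicator (P? (g i)))
length-filter-tabulate {n = zero}  P? g = refl
length-filter-tabulate {n = suc n} P? g with does (P? (g zero))
... | true  = cong suc (length-filter-tabulate P? (g ∘ suc))
... | false = length-filter-tabulate P? (g ∘ suc)

length-filter-cartesianProduct : {P : Pred (A × B) p} (P? : Decidable P) (g : Fin m → A) (h : Fin n → B) →
  length (filter P? (cartesianProduct (tabulate g) (tabulate h))) ≡
  sum (λ i → sum (λ j → indicator (P? (g i , h j))))
length-filter-cartesianProduct {m = zero}  P? g h = refl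
length-filter-cartesianProduct {m = suc m} P? g h = begin
  length (filter P? (firstRow ++ rest))
    ≡⟨ cong length (filter-++ P? firstRow rest) ⟩
  length (filter P? firstRow ++ filter P? rest)
    ≡⟨ length-++ (filter P? firstRow) ⟩
  length (filter P? firstRow) + length (filter P? rest)
    ≡⟨ cong₂ _+_
         (trans (cong (length ∘ filter P?) (map-tabulate h (g zero ,_)))
                (length-filter-tabulate P? (λ j → g zero , h j)))
         (length-filter-cartesianProduct P? (g ∘ suc) h) ⟩
  sum (λ i → sum (λ j → indicator (P? (g i , h j)))) ∎
  where
  open ≡-Reasoning
  firstRow = map (g zero ,_) (tabulate h)
  rest     = cartesianProduct (tabulate (g ∘ suc)) (tabulate h)

-- Oriented from labels to rows, so that `sum-permute` turns a sum over rows into a sum over labels.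
rowPermutation : PF n → Permutation n n
rowPermutation f = permutation position letter position-letter letter-position
  where open Rows f

readingPermutation : PF n → Permutation n n
readingPermutation f = permutation position letter position-letter letter-position
  where open Reading f

-- Every row holds exactly one label, so the row numbers add up to `sum toℕ` whatever `f` is. The
-- additive form avoids truncated subtraction of sums.
area+∑fun≡∑toℕ : (f : PF n) → area f + sum (toℕ ∘ fun f) ≡ sum {n} toℕ
area+∑fun≡∑toℕ {n} f = begin
  area f + sum (toℕ ∘ fun f)               ≡⟨ ∑-distrib-+ (rowArea f) (toℕ ∘ fun f) ⟨
  sum (λ x → rowArea f x + toℕ (fun f x))  ≡⟨ sum-cong-≗ (λ x → ℕ.m∸n+n≡m (fun≤row f x)) ⟩
  sum (toℕ ∘ row f)                        ≡⟨ sum-permute toℕ (rowPermutation f) ⟨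
  sum {n} toℕ                              ∎
  where open ≡-Reasoning

∑dinvCount+∑φ≡∑toℕ : (f : PF n) → sum (dinvCount f) + sum (toℕ ∘ φ-fun f) ≡ sum {n} toℕ
∑dinvCount+∑φ≡∑toℕ {n} f = begin
  sum (dinvCount f) + sum (toℕ ∘ φ-fun f)      ≡⟨ ∑-distrib-+ (dinvCount f) (toℕ ∘ φ-fun f) ⟨
  sum (λ x → dinvCount f x + toℕ (φ-fun f x))  ≡⟨ sum-cong-≗ dinvCount+φ≡position ⟩
  sum (toℕ ∘ position)                         ≡⟨ sum-permute toℕ (readingPermutation f) ⟨
  sum {n} toℕ                                  ∎
  where
  open ≡-Reasoning
  open Reading f
  dinvCount+φ≡position : ∀ x → dinvCount f x + toℕ (φ-fun f x) ≡ toℕ (position x)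
  -- The subtraction in `φ-fun` is exact because `dinvCount` counts only earlier positions.
  dinvCount+φ≡position x = trans (cong (dinvCount f x +_) (toℕ-fromℕ< _))
    (ℕ.m+[n∸m]≡n (dinvCount≤position f x))

-- The columns of `φ f` are `φ-fun f` by definition, so both identities have the same second summand
-- and the same total; cancel it.
area-φ : (f : PF n) → area (φ f) ≡ sum (dinvCount f)
area-φ f = ℕ.+-cancelʳ-≡ (sum (toℕ ∘ φ-fun f)) _ _
  (trans (area+∑fun≡∑toℕ (φ f)) (sym (∑dinvCount+∑φ≡∑toℕ f)))

module _ (f : PF n) where
  open Reading f
  open ≡-Reasoning

  private
    dinvPair : Fin n → Fin n → ℕ
    dinvPair x y = indicator (dinvPair? f (x , y))

    forward? : ∀ x y → Dec (position x < position y × DinvPair f (x , y))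
    forward? x y = position x <? position y ×-dec dinvPair? f (x , y)

    backward? : ∀ x y → Dec (position y < position x × DinvPair f (x , y))
    backward? x y = position y <? position x ×-dec dinvPair? f (x , y)

    -- Membership in Dinv(f) orients a pair by label: x is the smaller label, and
    -- forward or backward says whether the reading word agrees with that order.
    forward backward : Fin n → Fin n → ℕ
    forward  x y = indicator (forward? x y)
    backward x y = indicator (backward? x y)

  -- An earlier letter `x` paired with `y` is either the smaller label, giving `forward x y`, or the
  -- larger one, giving `backward y x`.
  dinvCount≡∑ : ∀ y → dinvCount f y ≡ sum (λ x → forward x y + backward y x)
  dinvCount≡∑ y = begin
    dinvCount f y
      ≡⟨ length-filter-tabulate (λ i → i <? position y ×-dec inDinv? f (letter i) y) id ⟩
    sum (λ i → indicator (i <? position y ×-dec inDinv? f (letter i) y))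
      ≡⟨ sum-permute _ (readingPermutation f) ⟩
    sum (λ x → indicator (position x <? position y ×-dec inDinv? f (letter (position x)) y))
      ≡⟨ sum-cong-≗ split ⟩
    sum (λ x → forward x y + backward y x) ∎
    where
    split : ∀ x → indicator (position x <? position y ×-dec inDinv? f (letter (position x)) y) ≡
                  forward x y + backward y x
    split x = trans
      (cong (λ z → indicator (position x <? position y ×-dec inDinv? f z y)) (letter-position x))
      (trans
        (indicator-⇔ (λ { (lt , inj₁ d) → inj₁ (lt , d) ; (lt , inj₂ d) → inj₂ (lt , d) })
                     (λ { (inj₁ (lt , d)) → lt , inj₁ d ; (inj₂ (lt , d)) → lt , inj₂ d })
                     (position x <? position y ×-dec inDinv? f x y)
                     (forward? x y ⊎-dec backward? y x))
        -- Both alternatives place `x` before `y` in the word; it is the label order that excludes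
        -- one of them.
        (indicator-⊎ (forward? x y) (backward? y x)
          λ (_ , x<y , _) (_ , y<x , _) → ℕ.<-asym x<y y<x))

  -- Here the label order is fixed, and the two letters occur in exactly one order in the reading
  -- word.
  forward+backward : ∀ x y → forward x y + backward x y ≡ dinvPair x y
  forward+backward x y = trans
    (sym (indicator-⊎ (forward? x y) (backward? x y) λ (lt , _) (gt , _) → ℕ.<-asym lt gt))
    (indicator-⇔ [ proj₂ , proj₂ ] compare (forward? x y ⊎-dec backward? x y) (dinvPair? f (x , y)))
    where
    compare : DinvPair f (x , y) → (position x < position y × DinvPair f (x , y))
                                 ⊎ (position y < position x × DinvPair f (x , y))
    compare d with <-cmp (position x) (position y)
    ... | tri< lt _ _ = inj₁ (lt , d)
    ... | tri> _ _ gt = inj₂ (gt , d)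
    -- Equal positions would force `x` and `y` to be the same label, against the `x < y` contained
    -- in `d`.
    ... | tri≈ _ eq _ = contradiction (proj₁ d) (ℕ.<-irrefl (cong toℕ (position-injective eq)))

  ∑dinvCount≡dinv : sum (dinvCount f) ≡ dinv f
  ∑dinvCount≡dinv = begin
    sum (dinvCount f)
      ≡⟨ sum-cong-≗ (λ y → trans (dinvCount≡∑ y) (∑-distrib-+ (λ x → forward x y) (backward y))) ⟩
    sum (λ y → sum (λ x → forward x y) + sum (backward y))
      ≡⟨ ∑-distrib-+ (λ y → sum (λ x → forward x y)) (λ y → sum (backward y)) ⟩
    sum (λ y → sum (λ x → forward x y)) + sum (λ x → sum (backward x))
      -- The later letter is the second argument of `forward` but the first of `backward`.
      -- Interchanging the first double sum makes the smaller label the outer index in both, so they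
      -- can be added pair by pair.
      ≡⟨ cong (_+ sum (λ x → sum (backward x))) (∑-comm (λ y x → forward x y)) ⟩
    sum (λ x → sum (forward x)) + sum (λ x → sum (backward x))
      ≡⟨ ∑-distrib-+ (λ x → sum (forward x)) (λ x → sum (backward x)) ⟨
    sum (λ x → sum (forward x) + sum (backward x))
      ≡⟨ sum-cong-≗ (λ x → trans (sym (∑-distrib-+ (forward x) (backward x)))
                                 (sum-cong-≗ (forward+backward x))) ⟩
    sum (λ x → sum (dinvPair x))
      ≡⟨ length-filter-cartesianProduct (dinvPair? f) id id ⟨
    dinv f ∎

proposition3p3 : (n : ℕ) → 1 ≤ n → (f : PF n) → dinv f ≡ area (φ f)
proposition3p3 n _ f = sym (trans (area-φ f) (∑dinvCount≡dinv f))
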